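{- Let $p$ be a prime and $m\ge 1$. The alternating forms graph $\mathrm{Alt}(5,p^m)$ is separating.
   Context: $\mathrm{Alt}(5,q)$ has as vertices the $5\times 5$ alternating matrices over $\mathbb{F}_q$ (skew-symmetric with zero diagonal), two matrices $A,B$ being adjacent if $\mathrm{rank}(A-B)=2$. A graph $\Gamma$ is separating if $\omega(\Gamma)\alpha(\Gamma)<|V(\Gamma)|$, where $\omega$ and $\alpha$ are the maximum clique and coclique sizes. -}

module Defs where

open import Level using (Level; _⊔_)
open import Data.Nat using (ℕ; zero; suc; _≤_)
open import Data.Fin using (Fin; zero; suc)
open import Data.Product using (Σ; _×_; _,_; ∃; ∃-syntax)
open import Data.List using (List; length)
open import Data.List.Relation.Unary.AllPairs using (AllPairs)
open import Data.List.Relation.Unary.Any using (Any)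
open import Relation.Nullary using (¬_)
open import Relation.Binary.PropositionalEquality using (_≡_)
open import Function.Definitions using (Injective)
open import Algebra.Bundles using (CommutativeRing)

HasSize : ∀ {a ℓ} (A : Set a) (_≈_ : A → A → Set ℓ) → ℕ → Set (a ⊔ ℓ)
HasSize A _≈_ N =
  Σ (List A) λ L → (length L ≡ N) × AllPairs (λ x y → ¬ (x ≈ y)) L × (∀ x → Any (x ≈_) L)

record IsField {c ℓ} (R : CommutativeRing c ℓ) : Set (c ⊔ ℓ) where
  open CommutativeRing R using (Carrier; _≈_; _+_; _*_; _-_; -_; 0#; 1#)
  field
    1≉0 : ¬ (1# ≈ 0#)
    inverse : ∀ x → ¬ (x ≈ 0#) → ∃[ y ] (x * y ≈ 1#)

module Graph {v ℓ ℓ'} (V : Set v) (_≈_ : V → V → Set ℓ) (Adj : V → V → Set ℓ') where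

  IsClique : List V → Set (v ⊔ ℓ ⊔ ℓ')
  IsClique = AllPairs (λ x y → ¬ (x ≈ y) × Adj x y)

  IsCoclique : List V → Set (v ⊔ ℓ ⊔ ℓ')
  IsCoclique = AllPairs (λ x y → ¬ (x ≈ y) × ¬ Adj x y)

  IsCliqueNumber : ℕ → Set (v ⊔ ℓ ⊔ ℓ')
  IsCliqueNumber k = (Σ (List V) λ C → IsClique C × length C ≡ k)
                   × (∀ C → IsClique C → length C ≤ k)

  IsCocliqueNumber : ℕ → Set (v ⊔ ℓ ⊔ ℓ')
  IsCocliqueNumber k = (Σ (List V) λ C → IsCoclique C × length C ≡ k)
                     × (∀ C → IsCoclique C → length C ≤ k)

module Matrices {c ℓ} (R : CommutativeRing c ℓ) where
  open CommutativeRing R using (Carrier; _≈_; _+_; _*_; _-_; -_; 0#; 1#)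

  Matrix : ℕ → ℕ → Set c
  Matrix m n = Fin m → Fin n → Carrier

  sumF : ∀ {r} → (Fin r → Carrier) → Carrier
  sumF {zero} f = 0#
  sumF {suc r} f = f zero + sumF (λ i → f (suc i))

  LinIndep : ∀ {r n} → (Fin r → Fin n → Carrier) → Set (c ⊔ ℓ)
  LinIndep {r} {n} rows =
    (coef : Fin r → Carrier) → (∀ j → sumF (λ i → coef i * rows i j) ≈ 0#) → ∀ i → coef i ≈ 0#

  HasRank : ∀ {m n} → Matrix m n → ℕ → Set (c ⊔ ℓ)
  HasRank {m} A k =
    (Σ (Fin k → Fin m) λ f → Injective _≡_ _≡_ f × LinIndep (λ i → A (f i)))
    × (∀ (f : Fin (suc k) → Fin m) → Injective _≡_ _≡_ f → ¬ LinIndep (λ i → A (f i)))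

  _-M_ : ∀ {m n} → Matrix m n → Matrix m n → Matrix m n
  (A -M B) i j = A i j - B i j

  _≈M_ : ∀ {m n} → Matrix m n → Matrix m n → Set ℓ
  A ≈M B = ∀ i j → A i j ≈ B i j

  IsAlternating : ∀ {n} → Matrix n n → Set ℓ
  IsAlternating A = (∀ i → A i i ≈ 0#) × (∀ i j → A i j ≈ - A j i)

  AltVertex : ℕ → Set (c ⊔ ℓ)
  AltVertex n = Σ (Matrix n n) IsAlternating

  _≈V_ : ∀ {n} → AltVertex n → AltVertex n → Set ℓ
  (A , _) ≈V (B , _) = A ≈M B

  AltAdj : ∀ {n} → AltVertex n → AltVertex n → Set (c ⊔ ℓ)
  AltAdj (A , _) (B , _) = HasRank (A -M B) 2

  module AltGraph (n : ℕ) = Graph (AltVertex n) _≈V_ AltAdj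

{-# OPTIONS --safe #-}

-- An alternating matrix has rank 2 iff it is nonzero and all its 4 × 4 Pfaffians vanish, so the
-- polar form of the Pfaffian vanishes on differences of members of a clique.  If a clique had more
-- than q⁴ members, then for any four matrix positions some nonzero difference would vanish there.
-- Taking D with D a b ≠ 0, then E with zero row a, G with zero row b and k with E b k ≠ 0, the
-- relations with D, E and G force every difference vanishing at (a,b), (a,k), (b,k) to be zero.
-- Hence ω ≤ q⁴.
--
-- For x ≠ 0 the matrices x ∧ y form a clique of size q⁴, so its translates by the members of a
-- coclique C are disjoint.  If ωα ≥ N then these translates cover all vertices, for every x.  Fix a
-- vertex A outside C: each x ≠ 0 has exactly one B ∈ C with A - B = x ∧ y for some y, and conversely
-- every B ∈ C at rank distance 2 from A arises from the q² - 1 nonzero x in the row space of A - B.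
-- So q² - 1 divides q⁵ - 1, hence q - 1, which is absurd.
module Submission where

open import Defs
open import Algebra.Bundles using (CommutativeRing)
open import Data.Fin using (Fin; zero; suc)
open import Data.Product using (_×_; _,_; proj₁; proj₂; ∃)
open import Data.Sum using (_⊎_; inj₁; inj₂)
open import Relation.Nullary using (¬_; Dec; yes; no; contradiction)
open import Relation.Binary.PropositionalEquality as ≡ using (_≡_; _≢_)

-- Polynomial identities with integer coefficients over a commutative ring.

module IntegerSolver {c ℓ} (R : CommutativeRing c ℓ) where
  open CommutativeRing R
  open import Data.Nat as ℕ using (ℕ; zero; suc)
  open import Data.Integer as ℤ using (ℤ; +_; -[1+_]; _⊖_)
  import Data.Integer.Properties as ℤ
  open import Algebra.Properties.Ring ring using (-0#≈0#; -‿distribˡ-*; -‿distribʳ-*; -‿involutive)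
  open import Algebra.Properties.AbelianGroup +-abelianGroup using (⁻¹-∙-comm)
  open import Algebra.Properties.Monoid.Mult +-monoid renaming (_×_ to _·_) using (×-homo-+)
  open import Algebra.Properties.Semiring.Mult semiring using (×1-homo-*)
  open import Algebra.Solver.Ring.AlmostCommutativeRing
  open import Relation.Binary.Reasoning.Setoid setoid
  open import Relation.Nullary.Decidable using (dec⇒maybe)
  open import Data.Maybe using (Maybe; map)

  -- Equality of integer coefficients is decidable, so the solver can cancel terms although equality
  -- in `R` is not assumed decidable.
  fromℤ : ℤ → Carrier
  fromℤ (+ n)    = n · 1#
  fromℤ -[1+ n ] = - (suc n · 1#)

  fromℤ-neg : ∀ i → fromℤ (ℤ.- i) ≈ - fromℤ i
  fromℤ-neg (+ zero)  = sym -0#≈0#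
  fromℤ-neg (+ suc n) = refl
  fromℤ-neg -[1+ n ]  = sym (-‿involutive _)

  cancel-suc : ∀ x y z → (x + y) - (x + z) ≈ y - z
  cancel-suc x y z = begin
    (x + y) - (x + z)        ≈⟨ +-cong (+-comm x y) (sym (⁻¹-∙-comm x z)) ⟩
    (y + x) + (- x + - z)    ≈⟨ +-assoc y x _ ⟩
    y + (x + (- x + - z))    ≈⟨ +-congˡ (sym (+-assoc x (- x) (- z))) ⟩
    y + (x - x + - z)        ≈⟨ +-congˡ (+-congʳ (-‿inverseʳ x)) ⟩
    y + (0# + - z)           ≈⟨ +-congˡ (+-identityˡ _) ⟩
    y - z                    ∎

  fromℤ-⊖ : ∀ m n → fromℤ (m ⊖ n) ≈ m · 1# - n · 1#
  fromℤ-⊖ m       zero    = sym (trans (+-congˡ -0#≈0#) (+-identityʳ _))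
  fromℤ-⊖ zero    (suc n) = sym (+-identityˡ _)
  fromℤ-⊖ (suc m) (suc n) = begin
    fromℤ (suc m ⊖ suc n)        ≡⟨ ≡.cong fromℤ (ℤ.[1+m]⊖[1+n]≡m⊖n m n) ⟩
    fromℤ (m ⊖ n)                ≈⟨ fromℤ-⊖ m n ⟩
    m · 1# - n · 1#              ≈⟨ cancel-suc 1# _ _ ⟨
    suc m · 1# - suc n · 1#      ∎

  fromℤ-+ : ∀ i j → fromℤ (i ℤ.+ j) ≈ fromℤ i + fromℤ j
  fromℤ-+ (+ m)    (+ n)    = ×-homo-+ 1# m n
  fromℤ-+ (+ m)    -[1+ n ] = fromℤ-⊖ m (suc n)
  fromℤ-+ -[1+ m ] (+ n)    = trans (fromℤ-⊖ n (suc m)) (+-comm _ _)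
  fromℤ-+ -[1+ m ] -[1+ n ] = begin
    - (suc (suc (m ℕ.+ n)) · 1#)       ≡⟨ ≡.cong (λ k → - (suc k · 1#)) (≡.sym (ℕ.+-suc m n)) ⟩
    - ((suc m ℕ.+ suc n) · 1#)         ≈⟨ -‿cong (×-homo-+ 1# (suc m) (suc n)) ⟩
    - (suc m · 1# + suc n · 1#)        ≈⟨ ⁻¹-∙-comm _ _ ⟨
    - (suc m · 1#) + - (suc n · 1#)    ∎
    where import Data.Nat.Properties as ℕ

  fromℤ-*-+ : ∀ i n → fromℤ (i ℤ.* + n) ≈ fromℤ i * (n · 1#)
  fromℤ-*-+ (+ m)    n = trans (reflexive (≡.cong fromℤ (≡.sym (ℤ.pos-* m n)))) (×1-homo-* m n)
  fromℤ-*-+ -[1+ m ] n = begin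
    fromℤ (-[1+ m ] ℤ.* + n)        ≡⟨ ≡.cong fromℤ (ℤ.neg-distribˡ-* (+ suc m) (+ n)) ⟨
    fromℤ (ℤ.- (+ suc m ℤ.* + n))   ≈⟨ fromℤ-neg (+ suc m ℤ.* + n) ⟩
    - fromℤ (+ suc m ℤ.* + n)       ≈⟨ -‿cong (fromℤ-*-+ (+ suc m) n) ⟩
    - ((suc m · 1#) * (n · 1#))     ≈⟨ -‿distribˡ-* _ _ ⟩
    - (suc m · 1#) * (n · 1#)       ∎

  fromℤ-* : ∀ i j → fromℤ (i ℤ.* j) ≈ fromℤ i * fromℤ j
  fromℤ-* i (+ n)    = fromℤ-*-+ i n
  fromℤ-* i -[1+ n ] = begin
    fromℤ (i ℤ.* -[1+ n ])          ≡⟨ ≡.cong fromℤ (ℤ.neg-distribʳ-* i (+ suc n)) ⟨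
    fromℤ (ℤ.- (i ℤ.* + suc n))     ≈⟨ fromℤ-neg (i ℤ.* + suc n) ⟩
    - fromℤ (i ℤ.* + suc n)         ≈⟨ -‿cong (fromℤ-*-+ i (suc n)) ⟩
    - (fromℤ i * (suc n · 1#))      ≈⟨ -‿distribʳ-* _ _ ⟩
    fromℤ i * - (suc n · 1#)        ∎

  fromℤ-morphism : ℤ.+-*-rawRing -Raw-AlmostCommutative⟶ fromCommutativeRing R
  fromℤ-morphism = record
    { ⟦_⟧    = fromℤ
    ; +-homo = fromℤ-+
    ; *-homo = fromℤ-*
    ; -‿homo = fromℤ-neg
    ; 0-homo = refl
    ; 1-homo = +-identityʳ 1#
    }

  open import Algebra.Solver.Ring ℤ.+-*-rawRing (fromCommutativeRing R) fromℤ-morphism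
    (λ i j → map (λ i≡j → reflexive (≡.cong fromℤ i≡j)) (dec⇒maybe (i ℤ.≟ j))) public
    using (solve; _:=_; _:+_; _:*_; _:-_; :-_; Polynomial; con)

  :0 : ∀ {n} → Polynomial n
  :0 = con (+ 0)



-- Pfaffians of alternating matrices and their polar form.

module Pfaffian {c ℓ} (R : CommutativeRing c ℓ) where
  open CommutativeRing R
  open IntegerSolver R
  open Matrices R
  open import Algebra.Properties.Ring ring using (-0#≈0#)

  open import Data.Nat using (ℕ)

  private variable n : ℕ

  infixr 6 _⊞_
  infix 7 _⊛_

  -- Together with `_⊞_` this certifies membership in an ideal: the solver writes the goal as a
  -- combination of vanishing expressions, and these operators discharge the combination.
  _⊛_ : ∀ a {x} → x ≈ 0# → a * x ≈ 0#
  a ⊛ x≈0 = trans (*-congˡ x≈0) (zeroʳ a)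

  _⊞_ : ∀ {x y} → x ≈ 0# → y ≈ 0# → x + y ≈ 0#
  x≈0 ⊞ y≈0 = trans (+-cong x≈0 y≈0) (+-identityˡ 0#)

  ≈0-neg : ∀ {x} → x ≈ 0# → - x ≈ 0#
  ≈0-neg h = trans (-‿cong h) -0#≈0#

  ≈⇒-≈0 : ∀ {x y} → x ≈ y → x - y ≈ 0#
  ≈⇒-≈0 {x} {y} x≈y = trans (+-congʳ x≈y) (-‿inverseʳ y)

  -≈0⇒≈ : ∀ {x y} → x - y ≈ 0# → x ≈ y
  -≈0⇒≈ {x} {y} h =
    trans (solve 2 (λ x y → x := (x :- y) :+ y) refl x y) (trans (+-congʳ h) (+-identityˡ y))

  alt-sum : ∀ {A : Matrix n n} → IsAlternating A → ∀ i j → A i j + A j i ≈ 0#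
  alt-sum (_ , anti) i j = trans (+-congʳ (anti i j)) (-‿inverseˡ _)

  alt-zero : ∀ {A : Matrix n n} → IsAlternating A → ∀ i j → A i j ≈ 0# → A j i ≈ 0#
  alt-zero (_ , anti) i j h = trans (anti j i) (trans (-‿cong h) -0#≈0#)

  -M-alternating : ∀ {A B : Matrix n n} → IsAlternating A → IsAlternating B → IsAlternating (A -M B)
  -M-alternating {A = A} {B} (dA , sA) (dB , sB) =
    (λ i → ≈⇒-≈0 (trans (dA i) (sym (dB i)))) ,
    (λ i j → trans (+-cong (sA i j) (-‿cong (sB i j)))
      (solve 2 (λ a b → :- a :- :- b := :- (a :- b)) refl (A j i) (B j i)))

  Pf : Matrix n n → Fin n → Fin n → Fin n → Fin n → Carrier
  Pf A i j k l = A i j * A k l - A i k * A j l + A i l * A j k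

  -- Repeated indices may be allowed, since the Pfaffian of an alternating matrix vanishes on them.
  Singular : Matrix n n → Set ℓ
  Singular A = ∀ i j k l → Pf A i j k l ≈ 0#

  Pf-cong : ∀ {A B : Matrix n n} → A ≈M B → ∀ i j k l → Pf A i j k l ≈ Pf B i j k l
  Pf-cong h i j k l = +-cong (+-cong (*-cong (h i j) (h k l)) (-‿cong (*-cong (h i k) (h j l)))) (*-cong (h i l) (h j k))

  Pf-swap : ∀ {A : Matrix n n} → IsAlternating A → ∀ i j k l → Pf A j i k l ≈ - Pf A i j k l
  Pf-swap {A = A} (_ , anti) i j k l =
    trans (+-congʳ (+-congʳ (*-congʳ (anti j i))))
      (solve 6 (λ ij kl ik jl il jk → :- ij :* kl :- jk :* il :+ jl :* ik := :- (ij :* kl :- ik :* jl :+ il :* jk))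
        refl (A i j) (A k l) (A i k) (A j l) (A i l) (A j k))

  Pf-rotate : ∀ {A : Matrix n n} → IsAlternating A → ∀ i j k l → Pf A k i j l ≈ Pf A i j k l
  Pf-rotate {A = A} (_ , anti) i j k l =
    trans (+-congʳ (+-cong (*-congʳ (anti k i)) (-‿cong (*-congʳ (anti k j)))))
      (solve 6 (λ ij kl ik jl il jk → :- ik :* jl :- :- jk :* il :+ kl :* ij := ij :* kl :- ik :* jl :+ il :* jk)
        refl (A i j) (A k l) (A i k) (A j l) (A i l) (A j k))

  Pf-repeat₁₂ : ∀ {A : Matrix n n} → IsAlternating A → ∀ i k l → Pf A i i k l ≈ 0#
  Pf-repeat₁₂ {A = A} (diag , _) i k l =
    trans (solve 4 (λ ii kl ik il → ii :* kl :- ik :* il :+ il :* ik := kl :* ii) refl (A i i) (A k l) (A i k) (A i l))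
      (A k l ⊛ diag i)

  Pf-repeat₁₃ : ∀ {A : Matrix n n} → IsAlternating A → ∀ i j l → Pf A i j i l ≈ 0#
  Pf-repeat₁₃ alt i j l = trans (sym (Pf-rotate alt i j i l)) (Pf-repeat₁₂ alt i j l)

  Pf-repeat₂₃ : ∀ {A : Matrix n n} → IsAlternating A → ∀ i j l → Pf A i j j l ≈ 0#
  Pf-repeat₂₃ alt i j l = trans (Pf-swap alt j i j l) (≈0-neg (Pf-repeat₁₃ alt j i l))

  -- Multiply by the Pfaffian adjugate of the principal submatrix on i, j, k, l.
  relation-Pf : ∀ {A : Matrix n n} → IsAlternating A → ∀ i j k l {a b d} →
    (∀ t → a * A i t + b * A j t + d * A k t ≈ 0#) → a * Pf A i j k l ≈ 0#
  relation-Pf {A = A} alt i j k l {a} {b} {d} rel =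
    trans
      (solve 12 (λ a b d ij kl ik jl il jk jj kj kk →
         a :* (ij :* kl :- ik :* jl :+ il :* jk) :=
           kl :* (a :* ij :+ b :* jj :+ d :* kj) :+ (:- jl :* (a :* ik :+ b :* jk :+ d :* kk)
             :+ (jk :* (a :* il :+ b :* jl :+ d :* kl) :+ (:- (b :* kl) :* jj
             :+ (:- (d :* kl) :* (jk :+ kj) :+ d :* jl :* kk)))))
         refl a b d (A i j) (A k l) (A i k) (A j l) (A i l) (A j k) (A j j) (A k j) (A k k))
      (_ ⊛ rel j ⊞ _ ⊛ rel k ⊞ _ ⊛ rel l ⊞ _ ⊛ proj₁ alt j ⊞ _ ⊛ alt-sum alt j k ⊞ _ ⊛ proj₁ alt k)

  -- This is Pf (A + B) - Pf A - Pf B, expanded as a bilinear form.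
  polar : Matrix n n → Matrix n n → Fin n → Fin n → Fin n → Fin n → Carrier
  polar A B i j k l =
    A i j * B k l - A i k * B j l + A i l * B j k + (A k l * B i j - A j l * B i k + A j k * B i l)

  -- For a quadratic form Q with polar form b, b (u₁ - u₂, u₃ - u₄) = Q (u₁ - u₄) + Q (u₂ - u₃) - Q
  -- (u₁ - u₃) - Q (u₂ - u₄). Here Q (x , y) = x y; there is no division by 2, so characteristic 2
  -- is covered.
  product-polarization : ∀ x₁ x₂ x₃ x₄ y₁ y₂ y₃ y₄ →
    (x₁ - x₂) * (y₃ - y₄) + (y₁ - y₂) * (x₃ - x₄)
      ≈ (x₁ - x₄) * (y₁ - y₄) + (x₂ - x₃) * (y₂ - y₃) - (x₁ - x₃) * (y₁ - y₃) - (x₂ - x₄) * (y₂ - y₄)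
  product-polarization = solve 8 (λ x₁ x₂ x₃ x₄ y₁ y₂ y₃ y₄ →
    (x₁ :- x₂) :* (y₃ :- y₄) :+ (y₁ :- y₂) :* (x₃ :- x₄)
      := (x₁ :- x₄) :* (y₁ :- y₄) :+ (x₂ :- x₃) :* (y₂ :- y₃) :- (x₁ :- x₃) :* (y₁ :- y₃) :- (x₂ :- x₄) :* (y₂ :- y₄))
    refl

  -- The six products of `polar` pair up into three instances of `product-polarization`, whose
  -- signed sum regroups into the four given Pfaffians.
  polar-differences : ∀ (A₁ A₂ A₃ A₄ : Matrix n n) →
    Singular (A₁ -M A₄) → Singular (A₂ -M A₃) → Singular (A₁ -M A₃) → Singular (A₂ -M A₄) →
    ∀ i j k l → polar (A₁ -M A₂) (A₃ -M A₄) i j k l ≈ 0#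
  polar-differences A₁ A₂ A₃ A₄ s₁₄ s₂₃ s₁₃ s₂₄ i j k l =
    trans (solve 6 (λ p q r s t u → p :- q :+ r :+ (s :- t :+ u) := (p :+ s) :- (q :+ t) :+ (r :+ u)) refl _ _ _ _ _ _)
    (trans (+-cong (+-cong (pol i j k l) (-‿cong (pol i k j l))) (pol i l j k))
    (trans (solve 12 (λ p p′ p″ p‴ q q′ q″ q‴ r r′ r″ r‴ →
         (p :+ p′ :- p″ :- p‴) :- (q :+ q′ :- q″ :- q‴) :+ (r :+ r′ :- r″ :- r‴)
         := (p :- q :+ r) :+ (p′ :- q′ :+ r′) :- (p″ :- q″ :+ r″) :- (p‴ :- q‴ :+ r‴)) refl _ _ _ _ _ _ _ _ _ _ _ _)
    (((s₁₄ i j k l ⊞ s₂₃ i j k l) ⊞ ≈0-neg (s₁₃ i j k l)) ⊞ ≈0-neg (s₂₄ i j k l))))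
    where
    pol : ∀ i j k l → _
    pol i j k l = product-polarization (A₁ i j) (A₂ i j) (A₃ i j) (A₄ i j) (A₁ k l) (A₂ k l) (A₃ k l) (A₄ k l)

  ≈0-matrix-singular : ∀ {A : Matrix n n} → (∀ i j → A i j ≈ 0#) → Singular A
  ≈0-matrix-singular A≈0 i j k l = (_ ⊛ A≈0 k l ⊞ ≈0-neg (_ ⊛ A≈0 j l)) ⊞ _ ⊛ A≈0 j k

  singular-cong : ∀ {A B : Matrix n n} → A ≈M B → Singular A → Singular B
  singular-cong A≈B sing i j k l = trans (sym (Pf-cong A≈B i j k l)) (sing i j k l)

  singular-difference-sym : ∀ {A B : Matrix n n} → Singular (A -M B) → Singular (B -M A)
  singular-difference-sym {A = A} {B} sing i j k l =
    trans (+-cong (+-cong (flip i j k l) (-‿cong (flip i k j l))) (flip i l j k)) (sing i j k l)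
    where
    flip : ∀ i j k l → (B i j - A i j) * (B k l - A k l) ≈ (A i j - B i j) * (A k l - B k l)
    flip i j k l = solve 4 (λ a b a′ b′ → (b :- a) :* (b′ :- a′) := (a :- b) :* (a′ :- b′)) refl
      (A i j) (B i j) (A k l) (B k l)

  -- Decomposable bivectors and the vectors dividing them.

  wedge : (Fin n → Carrier) → (Fin n → Carrier) → Matrix n n
  wedge x y i j = x i * y j - x j * y i

  wedge-alternating : ∀ (x y : Fin n → Carrier) → IsAlternating (wedge x y)
  wedge-alternating x y =
    (λ i → -‿inverseʳ _) ,
    (λ i j → solve 4 (λ a b d e → a :* e :- b :* d := :- (b :* d :- a :* e)) refl (x i) (x j) (y i) (y j))

  -- The three-term Plücker relation among the 2 × 2 minors of the pair `x`, `y`.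
  wedge-singular : ∀ (x y : Fin n → Carrier) → Singular (wedge x y)
  wedge-singular x y i j k l =
    solve 8 (λ a b c d e f g h →
      (a :* f :- b :* e) :* (c :* h :- d :* g) :- (a :* g :- c :* e) :* (b :* h :- d :* f)
        :+ (a :* h :- d :* e) :* (b :* g :- c :* f) := :0)
      refl (x i) (x j) (x k) (x l) (y i) (y j) (y k) (y l)

  -- x ∧ D = 0, where D is regarded as an element of Λ²; for x ≠ 0 it says that D = x ∧ y
  -- for some y.
  Inc : (Fin n → Carrier) → Matrix n n → Set ℓ
  Inc x D = ∀ i j k → x i * D j k - x j * D i k + x k * D i j ≈ 0#

  Inc-cong : ∀ {x x′ : Fin n → Carrier} {D D′ : Matrix n n} → (∀ i → x i ≈ x′ i) → D ≈M D′ → Inc x D → Inc x′ D′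
  Inc-cong x≈ D≈ inc i j k = trans (sym (+-cong (+-cong (*-cong (x≈ i) (D≈ j k)) (-‿cong (*-cong (x≈ j) (D≈ i k))))
    (*-cong (x≈ k) (D≈ i j)))) (inc i j k)

  Inc-wedge : ∀ (x y : Fin n → Carrier) → Inc x (wedge x y)
  Inc-wedge x y i j k =
    solve 6 (λ a b c d e f → a :* (b :* f :- c :* e) :- b :* (a :* f :- c :* d) :+ c :* (a :* e :- b :* d) := :0)
      refl (x i) (x j) (x k) (y i) (y j) (y k)

  Inc-difference : ∀ {x : Fin n → Carrier} {A B C : Matrix n n} → Inc x (A -M B) → Inc x (A -M C) → Inc x (B -M C)
  Inc-difference {x = x} {A} {B} {C} incB incC i j k =
    trans (solve 12 (λ x y z a b c a′ b′ c′ a″ b″ c″ →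
        x :* (a′ :- a″) :- y :* (b′ :- b″) :+ z :* (c′ :- c″) :=
          (x :* (a :- a″) :- y :* (b :- b″) :+ z :* (c :- c″)) :- (x :* (a :- a′) :- y :* (b :- b′) :+ z :* (c :- c′)))
        refl (x i) (x j) (x k) (A j k) (A i k) (A i j) (B j k) (B i k) (B i j) (C j k) (C i k) (C i j))
      (incC i j k ⊞ ≈0-neg (incB i j k))

  -- Solve the relation at `m`, `i`, `j` for `D i j`, dividing by `x m`; the second factor is thus
  -- row `m` of `D` divided by `x m`.
  Inc⇒wedge : ∀ {x : Fin n → Carrier} {D : Matrix n n} m w → x m * w ≈ 1# → Inc x D →
    D ≈M wedge x (λ j → w * D m j)
  Inc⇒wedge {x = x} {D} m w xw≈1 inc i j = -≈0⇒≈
    (trans (solve 8 (λ xm xi xj w dij dmi dmj one →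
        dij :- (xi :* (w :* dmj) :- xj :* (w :* dmi)) :=
          w :* (xm :* dij :- xi :* dmj :+ xj :* dmi) :+ dij :* (one :- xm :* w) :+ (dij :- dij :* one))
        refl (x m) (x i) (x j) w (D i j) (D m i) (D m j) 1#)
      ((w ⊛ inc m i j ⊞ D i j ⊛ ≈⇒-≈0 (sym xw≈1)) ⊞ ≈⇒-≈0 (sym (*-identityʳ _))))

  -- In the difference of the two relations at `i`, `j`, `k` the other two terms cancel. So where
  -- `D i j` is nonzero, the coordinates at `i` and `j` determine the vector.
  Inc-determined : ∀ {x x′ : Fin n → Carrier} {D : Matrix n n} i j → Inc x D → Inc x′ D →
    x i ≈ x′ i → x j ≈ x′ j → ∀ k → D i j * (x k - x′ k) ≈ 0#
  Inc-determined {x = x} {x′} {D} i j inc inc′ hi hj k =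
    trans (solve 9 (λ xi xj xk yi yj yk dij dik djk →
        dij :* (xk :- yk) :=
          (xi :* djk :- xj :* dik :+ xk :* dij) :+ (:- (yi :* djk :- yj :* dik :+ yk :* dij)
          :+ (:- djk :* (xi :- yi) :+ dik :* (xj :- yj))))
        refl (x i) (x j) (x k) (x′ i) (x′ j) (x′ k) (D i j) (D i k) (D j k))
      (inc i j k ⊞ ≈0-neg (inc′ i j k) ⊞ _ ⊛ ≈⇒-≈0 hi ⊞ _ ⊛ ≈⇒-≈0 hj)

  -- The combination of rows `i` and `j` of an alternating `D` with coordinates `u` at `i` and `v`
  -- at `j`, when `w` is the inverse of `D i j`.
  span : Matrix n n → Fin n → Fin n → Carrier → Carrier → Carrier → Fin n → Carrier
  span D i j w u v k = w * (v * D i k - u * D j k)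

  -- For row `i` of `D` the incidence expression at `r`, `s`, `t` is `Pf D i r s t`, and it is
  -- linear in the vector.
  span-Inc : ∀ {D : Matrix n n} → Singular D → ∀ i j w u v → Inc (span D i j w u v) D
  span-Inc {D = D} sing i j w u v r s t =
    trans (solve 12 (λ w u v ir is it jr js jt rs rt st →
        (w :* (v :* ir :- u :* jr)) :* st :- (w :* (v :* is :- u :* js)) :* rt :+ (w :* (v :* it :- u :* jt)) :* rs :=
          w :* v :* (ir :* st :- is :* rt :+ it :* rs) :+ :- (w :* u) :* (jr :* st :- js :* rt :+ jt :* rs))
        refl w u v (D i r) (D i s) (D i t) (D j r) (D j s) (D j t) (D r s) (D r t) (D s t))
      (_ ⊛ sing i r s t ⊞ _ ⊛ sing j r s t)

  span-left : ∀ {D : Matrix n n} → IsAlternating D → ∀ i j {w} u v → D i j * w ≈ 1# → span D i j w u v i ≈ u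
  span-left {D = D} alt i j {w} u v dw≈1 = -≈0⇒≈
    (trans (solve 7 (λ w u v ii ij ji one →
        w :* (v :* ii :- u :* ji) :- u :=
          w :* v :* ii :+ (:- (w :* u) :* (ij :+ ji) :+ (u :* (ij :* w :- one) :+ (u :* one :- u))))
        refl w u v (D i i) (D i j) (D j i) 1#)
      (_ ⊛ proj₁ alt i ⊞ _ ⊛ alt-sum alt i j ⊞ _ ⊛ ≈⇒-≈0 dw≈1 ⊞ ≈⇒-≈0 (*-identityʳ u)))

  span-right : ∀ {D : Matrix n n} → IsAlternating D → ∀ i j {w} u v → D i j * w ≈ 1# → span D i j w u v j ≈ v
  span-right {D = D} alt i j {w} u v dw≈1 = -≈0⇒≈
    (trans (solve 6 (λ w u v jj ij one →
        w :* (v :* ij :- u :* jj) :- v := :- (w :* u) :* jj :+ (v :* (ij :* w :- one) :+ (v :* one :- v)))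
        refl w u v (D j j) (D i j) 1#)
      (_ ⊛ proj₁ alt j ⊞ _ ⊛ ≈⇒-≈0 dw≈1 ⊞ ≈⇒-≈0 (*-identityʳ v)))

-- Counting in finite setoids.

module Enumeration where
  open import Level using (Level)
  open import Data.Nat as ℕ using (ℕ; zero; suc; _^_; _≤_; _<_)
  open import Data.Fin.Properties as Fin using (injective⇒≤; pigeonhole; *↔×; +↔⊎; <⇒≢; finToFun-funToFin; funToFin-finToFin)
  open import Data.Fin using (funToFin; finToFun; combine)
  open import Data.List using (List; _∷_; length; lookup; filter; allFin)
  open import Data.List.Relation.Unary.All using (All; _∷_)
  import Data.List.Relation.Unary.All as All
  open import Data.List.Relation.Unary.All.Properties using (all-filter)
  open import Data.List.Relation.Unary.Any using (Any; index)
  open import Data.List.Relation.Unary.Any.Properties using (lookup-index)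
  open import Data.List.Relation.Unary.AllPairs using (AllPairs; _∷_)
  open import Data.List.Relation.Unary.Unique.Propositional.Properties using (allFin⁺; filter⁺)
  open import Data.List.Membership.Propositional.Properties using (∈-filter⁺; ∈-allFin; ∈-lookup)
  open import Function.Bundles using (Inverse; mk↔ₛ′)
  open import Function.Construct.Composition using (inverse)
  open import Function.Construct.Symmetry using () renaming (inverse to symmetric)
  open import Relation.Binary.Bundles using (Setoid)
  open import Data.Product.Relation.Binary.Pointwise.NonDependent using (_×ₛ_; Pointwise-≡↔≡)
  import Data.Sum.Relation.Binary.Pointwise as Sum
  open Sum using (_⊎ₛ_)
  open import Data.Product.Function.NonDependent.Setoid using (_×-inverse_)
  open import Data.Sum.Function.Setoid using (_⊎-inverse_)
  open import Data.Vec.Functional.Relation.Binary.Equality.Setoid using (≋-setoid)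
  open import Relation.Unary using (Decidable)
  open import Relation.Binary.Definitions using (Symmetric)
  import Relation.Binary.Construct.On as On
  open import Relation.Nullary.Decidable using (map′)

  private variable
    a ℓ b ℓ′ : Level
    m n : ℕ

  Finite : Setoid a ℓ → ℕ → Set _
  Finite S n = Inverse S (≡.setoid (Fin n))

  AllPairs-lookup : ∀ {A : Set a} {R : A → A → Set ℓ} → Symmetric R → ∀ {xs} → AllPairs R xs →
    ∀ i j → i ≢ j → R (lookup xs i) (lookup xs j)
  AllPairs-lookup sym (h ∷ hs) zero    zero    i≢j = contradiction ≡.refl i≢j
  AllPairs-lookup sym (h ∷ hs) zero    (suc j) i≢j = All.lookup h (∈-lookup j)
  AllPairs-lookup sym (h ∷ hs) (suc i) zero    i≢j = sym (All.lookup h (∈-lookup i))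
  AllPairs-lookup sym (h ∷ hs) (suc i) (suc j) i≢j =
    AllPairs-lookup sym hs i j (λ i≡j → i≢j (≡.cong suc i≡j))

  finite-from-size : (S : Setoid a ℓ) → HasSize (Setoid.Carrier S) (Setoid._≈_ S) n → Finite S n
  finite-from-size S (L , ≡.refl , distinct , complete) = record
    { to        = λ x → index (complete x)
    ; from      = lookup L
    ; to-cong   = λ {x} {y} x≈y → index-unique _ _
        (trans (sym (lookup-index (complete x))) (trans x≈y (lookup-index (complete y))))
    ; from-cong = λ { ≡.refl → refl }
    ; inverse   = (λ {i} {x} x≈ → index-unique _ _ (trans (sym (lookup-index (complete x))) x≈))
                , (λ { {x} ≡.refl → sym (lookup-index (complete x)) })
    }
    where
    open Setoid S
    index-unique : ∀ i j → lookup L i ≈ lookup L j → i ≡ j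
    index-unique i j eq with i Fin.≟ j
    ... | yes i≡j = i≡j
    ... | no  i≢j = contradiction eq (AllPairs-lookup (λ h e → h (sym e)) distinct i j i≢j)

  module _ {S : Setoid a ℓ} (fin : Finite S n) where
    open Setoid S
    open Inverse fin

    to-injective : ∀ {x y} → to x ≡ to y → x ≈ y
    to-injective eq = trans (sym (strictlyInverseʳ _)) (trans (from-cong eq) (strictlyInverseʳ _))

    -- This supplies the decidable equality of the finite field that `Ranks` takes as a parameter.
    finite-≟ : ∀ x y → Dec (x ≈ y)
    finite-≟ x y = map′ to-injective to-cong (to x Fin.≟ to y)

    finite-collision : n < m → (f : Fin m → Carrier) → ∃ λ i → ∃ λ j → i ≢ j × f i ≈ f j
    finite-collision n<m f with i , j , i<j , eq ← pigeonhole n<m (λ i → to (f i)) =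
      i , j , <⇒≢ i<j , to-injective eq

  -- The map is applied only to the representatives `from i`, so it may be built from case
  -- distinctions and choices, as `φ` and `ψ` are below.
  finite-≤ : {S : Setoid a ℓ} {T : Setoid b ℓ′} → Finite S m → Finite T n →
    (f : Setoid.Carrier S → Setoid.Carrier T) →
    (∀ x y → Setoid._≈_ T (f x) (f y) → Setoid._≈_ S x y) → m ≤ n
  finite-≤ {S = S} finS finT f inj = injective⇒≤ {f = λ i → Inverse.to finT (f (Inverse.from finS i))}
    (λ {i} {j} eq → ≡.trans (≡.sym (Inverse.strictlyInverseˡ finS i))
      (≡.trans (Inverse.to-cong finS (inj _ _ (to-injective finT eq))) (Inverse.strictlyInverseˡ finS j)))

  finite-Fin : ∀ n → Finite (≡.setoid (Fin n)) n
  finite-Fin n = mk↔ₛ′ (λ i → i) (λ i → i) (λ _ → ≡.refl) (λ _ → ≡.refl)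

  finite-× : {S : Setoid a ℓ} {T : Setoid b ℓ′} → Finite S m → Finite T n → Finite (S ×ₛ T) (m ℕ.* n)
  finite-× finS finT = inverse (inverse (finS ×-inverse finT) Pointwise-≡↔≡) (symmetric *↔×)

  finite-⊎ : {S : Setoid a ℓ} {T : Setoid b ℓ′} → Finite S m → Finite T n → Finite (S ⊎ₛ T) (m ℕ.+ n)
  finite-⊎ finS finT = inverse (inverse (finS ⊎-inverse finT) (Sum.Pointwise-≡↔≡ _ _)) (symmetric +↔⊎)

  funToFin-cong : ∀ {k} {f g : Fin k → Fin n} → (∀ i → f i ≡ g i) → funToFin f ≡ funToFin g
  funToFin-cong {k = zero}  eq = ≡.refl
  funToFin-cong {k = suc k} eq = ≡.cong₂ combine (eq zero) (funToFin-cong (λ i → eq (suc i)))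

  finite-→ : {S : Setoid a ℓ} → Finite S n → ∀ k → Finite (≋-setoid S k) (n ^ k)
  finite-→ {n = n} {S = S} fin k = record
    { to        = λ f → funToFin (λ i → to (f i))
    ; from      = λ c i → from (finToFun c i)
    ; to-cong   = λ f≈g → funToFin-cong (λ i → to-cong (f≈g i))
    ; from-cong = λ { ≡.refl i → refl }
    ; inverse   =
        (λ {c} {f} f≈ → ≡.trans (funToFin-cong (λ i → ≡.trans (to-cong (f≈ i)) (strictlyInverseˡ _)))
          (funToFin-finToFin {k} {n} c))
      , (λ { {f} ≡.refl i → trans (from-cong (finToFun-funToFin (λ i → to (f i)) i)) (strictlyInverseʳ (f i)) })
    }
    where
    open Setoid S
    open Inverse fin

  -- Comparing first components only keeps different proofs of `P` from being counted separately.
  subset-setoid : (Fin n → Set ℓ) → Setoid _ _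
  subset-setoid {n = n} P = On.setoid {B = ∃ P} (≡.setoid (Fin n)) proj₁

  finite-subset : {P : Fin n → Set ℓ} → Decidable P → ∃ (Finite (subset-setoid P))
  finite-subset {n = n} {P = P} P? = length L , record
    { to        = λ (i , p) → index (member i p)
    ; from      = λ t → lookup L t , All.lookup (all-filter P? (allFin n)) (∈-lookup t)
    ; to-cong   = λ { {i , p} {j , p′} i≡j →
        index-unique _ _ (≡.trans (≡.sym (lookup-index (member i p))) (≡.trans i≡j (lookup-index (member j p′)))) }
    ; from-cong = ≡.cong (lookup L)
    ; inverse   = (λ {t} {(i , p)} i≡ → index-unique _ _ (≡.trans (≡.sym (lookup-index (member i p))) i≡))
                , (λ { {i , p} ≡.refl → ≡.sym (lookup-index (member i p)) })
    }
    where
    L : List (Fin n)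
    L = filter P? (allFin n)

    member : ∀ i → P i → Any (i ≡_) L
    member i p = ∈-filter⁺ P? (∈-allFin i) p

    index-unique : ∀ i j → lookup L i ≡ lookup L j → i ≡ j
    index-unique i j eq with i Fin.≟ j
    ... | yes i≡j = i≡j
    ... | no  i≢j = contradiction eq (AllPairs-lookup (λ h e → h (≡.sym e)) (filter⁺ P? (allFin⁺ n)) i j i≢j)

-- Rank two and vanishing Pfaffians over a field.

module Ranks {c ℓ} (R : CommutativeRing c ℓ) (isField : IsField R)
  (_≟_ : ∀ x y → Dec (CommutativeRing._≈_ R x y)) where
  open CommutativeRing R hiding (zero)
  open IntegerSolver R
  open Matrices R
  open Pfaffian R
  open IsField isField
  open import Data.Nat using (ℕ)
  open import Data.Fin.Properties as Fin using (any?; all?)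
  open import Data.Vec.Functional using ([]; _∷_)
  open import Relation.Nullary.Decidable using (¬?; decidable-stable)

  private variable n : ℕ

  cancelˡ-≈0 : ∀ {x y} → ¬ x ≈ 0# → x * y ≈ 0# → y ≈ 0#
  cancelˡ-≈0 {x} {y} x≉0 xy≈0 with w , xw≈1 ← inverse x x≉0 =
    trans (solve 4 (λ x y w one → y := w :* (x :* y) :+ (y :* (one :- x :* w) :+ (y :- y :* one))) refl x y w 1#)
      (w ⊛ xy≈0 ⊞ y ⊛ ≈⇒-≈0 (sym xw≈1) ⊞ ≈⇒-≈0 (sym (*-identityʳ y)))

  cancelʳ-≈0 : ∀ {x y} → ¬ y ≈ 0# → x * y ≈ 0# → x ≈ 0#
  cancelʳ-≈0 y≉0 xy≈0 = cancelˡ-≈0 y≉0 (trans (*-comm _ _) xy≈0)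

  nonzero-entry : ∀ {D : Matrix n n} → ¬ (∀ i j → D i j ≈ 0#) → ∃ λ i → ∃ λ j → ¬ D i j ≈ 0#
  nonzero-entry {D = D} D≉0 = decidable-stable (any? λ i → any? λ j → ¬? (D i j ≟ 0#))
    λ none → D≉0 λ i j → decidable-stable (D i j ≟ 0#) λ h → none (i , j , h)

  nonzero-coordinate : ∀ {x : Fin n → Carrier} → ¬ (∀ i → x i ≈ 0#) → ∃ λ i → ¬ x i ≈ 0#
  nonzero-coordinate {x = x} x≉0 = decidable-stable (any? λ i → ¬? (x i ≟ 0#))
    λ none → x≉0 λ i → decidable-stable (x i ≟ 0#) λ h → none (i , h)

  singular? : (D : Matrix n n) → Dec (Singular D)
  singular? D = all? λ i → all? λ j → all? λ k → all? λ l → Pf D i j k l ≟ 0#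

  Inc? : (x : Fin n → Carrier) (D : Matrix n n) → Dec (Inc x D)
  Inc? x D = all? λ i → all? λ j → all? λ k → (x i * D j k - x j * D i k + x k * D i j) ≟ 0#

  -- A nonzero Pfaffian would make rows `i`, `j`, `k` distinct and independent: `relation-Pf` kills
  -- the first coefficient of a relation, and `Pf-swap` and `Pf-rotate` bring the other two rows to
  -- the front.
  rank2⇒singular : ∀ {A : Matrix n n} → IsAlternating A → HasRank A 2 → Singular A
  rank2⇒singular {A = A} alt (_ , dependent) i j k l = decidable-stable (Pf A i j k l ≟ 0#) λ Pf≉0 →
    let
      i≢j : i ≢ j
      i≢j = λ { ≡.refl → Pf≉0 (Pf-repeat₁₂ alt i k l) }
      i≢k : i ≢ k
      i≢k = λ { ≡.refl → Pf≉0 (Pf-repeat₁₃ alt i j l) }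
      j≢k : j ≢ k
      j≢k = λ { ≡.refl → Pf≉0 (Pf-repeat₂₃ alt i j l) }
    in dependent (i ∷ j ∷ k ∷ [])
      (λ { {zero} {zero} _ → ≡.refl
         ; {zero} {suc zero} e → contradiction e i≢j
         ; {zero} {suc (suc zero)} e → contradiction e i≢k
         ; {suc zero} {zero} e → contradiction (≡.sym e) i≢j
         ; {suc zero} {suc zero} _ → ≡.refl
         ; {suc zero} {suc (suc zero)} e → contradiction e j≢k
         ; {suc (suc zero)} {zero} e → contradiction (≡.sym e) i≢k
         ; {suc (suc zero)} {suc zero} e → contradiction (≡.sym e) j≢k
         ; {suc (suc zero)} {suc (suc zero)} _ → ≡.refl })
      (λ coef rel → λ
         { zero → cancelʳ-≈0 Pf≉0 (relation-Pf alt i j k l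
             (λ t → trans (solve 3 (λ a b d → a :+ b :+ d := a :+ (b :+ (d :+ :0))) refl _ _ _) (rel t)))
         ; (suc zero) → cancelʳ-≈0 Pf≉0 (≈0-of-neg (trans (-‿*ʳ _ _) (trans (*-congˡ (sym (Pf-swap alt i j k l)))
             (relation-Pf alt j i k l
             (λ t → trans (solve 3 (λ a b d → b :+ a :+ d := a :+ (b :+ (d :+ :0))) refl _ _ _) (rel t))))))
         ; (suc (suc zero)) → cancelʳ-≈0 Pf≉0 (trans (*-congˡ (sym (Pf-rotate alt i j k l))) (relation-Pf alt k i j l
             (λ t → trans (solve 3 (λ a b d → d :+ a :+ b := a :+ (b :+ (d :+ :0))) refl _ _ _) (rel t)))) })
    where
    ≈0-of-neg : ∀ {x} → - x ≈ 0# → x ≈ 0#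
    ≈0-of-neg {x} h = trans (solve 1 (λ x → x := :- :- x) refl x) (≈0-neg h)
    -‿*ʳ : ∀ x y → - (x * y) ≈ x * - y
    -‿*ʳ = solve 2 (λ x y → :- (x :* y) := x :* :- y) refl

  -- Rows `i` and `j` with `A i j` nonzero are independent, because columns `j` and `i` isolate the
  -- two coefficients.
  singular⇒rank2 : ∀ {A : Matrix n n} → IsAlternating A → Singular A → ¬ (∀ i j → A i j ≈ 0#) → HasRank A 2
  singular⇒rank2 {A = A} alt sing A≉0 with i , j , Aij≉0 ← nonzero-entry A≉0 =
    (i ∷ j ∷ [] ,
      (λ { {zero} {zero} _ → ≡.refl
         ; {zero} {suc zero} e → contradiction e (i≢j Aij≉0)
         ; {suc zero} {zero} e → contradiction (≡.sym e) (i≢j Aij≉0)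
         ; {suc zero} {suc zero} _ → ≡.refl }) ,
      (λ coef rel → λ
         { zero → cancelʳ-≈0 Aij≉0
             (trans (solve 4 (λ a b ij jj → a :* ij := (a :* ij :+ (b :* jj :+ :0)) :+ :- b :* jj) refl
               (coef zero) (coef (suc zero)) (A i j) (A j j)) (rel j ⊞ _ ⊛ proj₁ alt j))
         ; (suc zero) → cancelʳ-≈0 (λ h → Aij≉0 (alt-zero alt j i h))
             (trans (solve 4 (λ a b ii ji → b :* ji := (a :* ii :+ (b :* ji :+ :0)) :+ :- a :* ii) refl
               (coef zero) (coef (suc zero)) (A i i) (A j i)) (rel i ⊞ _ ⊛ proj₁ alt i)) })) ,
    (λ f _ indep → three-dependent (f zero) (f (suc zero)) (f (suc (suc zero))) λ a b d rel →
       let z = indep (a ∷ b ∷ d ∷ []) (λ t →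
                 trans (solve 3 (λ a b d → a :+ (b :+ (d :+ :0)) := a :+ b :+ d) refl _ _ _) (rel t))
       in z zero , z (suc zero) , z (suc (suc zero)))
    where
    i≢j : ∀ {i j} → ¬ A i j ≈ 0# → i ≢ j
    i≢j Aij≉0 ≡.refl = Aij≉0 (proj₁ alt _)

    -- The Pfaffians on `r`, `s`, `t`, `m` form a relation among the three rows with last
    -- coefficient `A r s`, which must vanish. Then `A s l` times row `r` minus `A r l` times row
    -- `s` is zero, so every `A r l` vanishes, and a zero row is not independent.
    three-dependent : ∀ r s t →
      ¬ (∀ a b d → (∀ m → a * A r m + b * A s m + d * A t m ≈ 0#) → a ≈ 0# × b ≈ 0# × d ≈ 0#)
    three-dependent r s t indep = 1≉0 (proj₁ (indep 1# 0# 0# λ m →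
        trans (solve 4 (λ one x y z → one :* x :+ :0 :* y :+ :0 :* z := one :* x) refl 1# (A r m) (A s m) (A t m))
          (1# ⊛ row-zero m)))
      where
      rs≈0 : A r s ≈ 0#
      rs≈0 = proj₂ (proj₂ (indep (A s t) (- A r t) (A r s) λ m →
        trans (solve 6 (λ st rm rt sm rs tm → st :* rm :+ (:- rt) :* sm :+ rs :* tm := rs :* tm :- rt :* sm :+ rm :* st)
          refl (A s t) (A r m) (A r t) (A s m) (A r s) (A t m)) (sing r s t m)))
      row-zero : ∀ l → A r l ≈ 0#
      row-zero l = trans (solve 1 (λ x → x := :- :- x) refl _) (≈0-neg (proj₁ (proj₂ (indep (A s l) (- A r l) 0# λ m →
        trans (solve 7 (λ sl rm rl sm z rs lm →
            sl :* rm :+ (:- rl) :* sm :+ :0 :* z := (rs :* lm :- rl :* sm :+ rm :* sl) :+ :- lm :* rs)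
          refl (A s l) (A r m) (A r l) (A s m) (A t m) (A r s) (A l m))
          (sing r s l m ⊞ _ ⊛ rs≈0)))))

  Inc⇒singular : ∀ {x : Fin n → Carrier} {D : Matrix n n} → ¬ (∀ i → x i ≈ 0#) → Inc x D → Singular D
  Inc⇒singular {x = x} {D} x≉0 inc with m , xm≉0 ← nonzero-coordinate x≉0 with w , xw≈1 ← inverse (x m) xm≉0 =
    singular-cong (λ i j → sym (Inc⇒wedge m w xw≈1 inc i j)) (wedge-singular x (λ j → w * D m j))

  -- Of the six products in the polar form only A a l * E b k survives.
  polar-transfer : ∀ (A E : Matrix n n) {a b k} → (∀ l → polar A E a b k l ≈ 0#) →
    (∀ t → E a t ≈ 0#) → ¬ E b k ≈ 0# → A a b ≈ 0# → A a k ≈ 0# → ∀ l → A a l ≈ 0#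
  polar-transfer A E {a} {b} {k} pol Ea≈0 Ebk≉0 Aab≈0 Aak≈0 l = cancelʳ-≈0 Ebk≉0
    (trans (solve 12 (λ ab kl ak bl al bk ab′ kl′ ak′ bl′ al′ bk′ →
        al :* bk′ := (ab :* kl′ :- ak :* bl′ :+ al :* bk′ :+ (kl :* ab′ :- bl :* ak′ :+ bk :* al′))
          :+ (:- kl′ :* ab :+ (bl′ :* ak :+ (:- kl :* ab′ :+ (bl :* ak′ :+ :- bk :* al′)))))
        refl (A a b) (A k l) (A a k) (A b l) (A a l) (A b k) (E a b) (E k l) (E a k) (E b l) (E a l) (E b k))
      (pol l ⊞ _ ⊛ Aab≈0 ⊞ _ ⊛ Aak≈0 ⊞ _ ⊛ Ea≈0 b ⊞ _ ⊛ Ea≈0 k ⊞ _ ⊛ Ea≈0 l))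

  -- Every product in the polar form other than `D a b * E k l` has a factor from row `a` or row `b`
  -- of `E`.
  polar-two-rows : ∀ (D E : Matrix n n) {a b} → (∀ k l → polar D E a b k l ≈ 0#) → ¬ D a b ≈ 0# →
    (∀ t → E a t ≈ 0#) → (∀ t → E b t ≈ 0#) → ∀ k l → E k l ≈ 0#
  polar-two-rows D E {a} {b} pol Dab≉0 Ea≈0 Eb≈0 k l = cancelˡ-≈0 Dab≉0
    (trans (solve 12 (λ ab kl ak bl al bk ab′ kl′ ak′ bl′ al′ bk′ →
        ab :* kl′ := (ab :* kl′ :- ak :* bl′ :+ al :* bk′ :+ (kl :* ab′ :- bl :* ak′ :+ bk :* al′))
          :+ (ak :* bl′ :+ (:- al :* bk′ :+ (:- kl :* ab′ :+ (bl :* ak′ :+ :- bk :* al′)))))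
        refl (D a b) (D k l) (D a k) (D b l) (D a l) (D b k) (E a b) (E k l) (E a k) (E b l) (E a l) (E b k))
      (pol k l ⊞ _ ⊛ Eb≈0 l ⊞ _ ⊛ Eb≈0 k ⊞ _ ⊛ Ea≈0 b ⊞ _ ⊛ Ea≈0 k ⊞ _ ⊛ Ea≈0 l))

-- Arithmetic incompatibility of the two counts.

module Counting where
  open import Data.Nat as ℕ using (ℕ; suc; _+_; _*_; _^_; _≤_; _<_)
  import Data.Nat.Properties as ℕ
  open import Data.Nat.Divisibility using (_∣_; divides; ∣m+n∣m⇒∣n; ∣⇒≤)
  open import Data.Nat.Tactic.RingSolver using (solve-∀)

  -- Modulo s = q ^ 2 - 1 the equation reads q ≡ 1.
  counts-incompatible : ∀ {q} M → 2 ≤ q → q ^ 5 + M ≢ 1 + M * (q * q)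
  counts-incompatible {suc (suc t)} M (ℕ.s≤s (ℕ.s≤s ℕ.z≤n)) eq = ℕ.<⇒≱ r<s (∣⇒≤ s∣r)
    where
    -- With q = r + 1, `s` is q² - 1 and `k` is q (q² + 1), so that q⁵ - q = s k.
    r s k : ℕ
    r = suc t
    s = r * r + 2 * r
    k = 2 * suc r + s * suc r

    expand : ∀ r M → 1 + M + (r + (r * r + 2 * r) * (2 * suc r + (r * r + 2 * r) * suc r))
      ≡ (suc r * (suc r * (suc r * (suc r * (suc r * 1))))) + M
    expand = solve-∀

    collect : ∀ r M → 1 + M * (suc r * suc r) ≡ 1 + M + M * (r * r + 2 * r)
    collect = solve-∀

    multiple : s * k + r ≡ M * s
    multiple = ≡.trans (ℕ.+-comm (s * k) r)
      (ℕ.+-cancelˡ-≡ (1 + M) _ _ (≡.trans (expand r M) (≡.trans eq (collect r M))))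

    s∣r : s ∣ r
    s∣r = ∣m+n∣m⇒∣n (divides M multiple) (divides k (ℕ.*-comm s k))

    r<s : r < s
    r<s = ≡.subst (r <_) (expand′ t) (ℕ.m<m+n r (ℕ.s≤s ℕ.z≤n))
      where
      expand′ : ∀ t → suc t + suc (t * t + 3 * t + 1) ≡ suc t * suc t + 2 * suc t
      expand′ = solve-∀

-- Cliques and cocliques over a field with q elements.

module Separation {c ℓ} (R : CommutativeRing c ℓ) (isField : IsField R) {q}
  (field-size : HasSize (CommutativeRing.Carrier R) (CommutativeRing._≈_ R) q) where
  open CommutativeRing R hiding (zero; _+_; _*_)
  module R = CommutativeRing R
  import Level
  open Enumeration
  open Counting
  fieldFinite : Finite setoid q
  fieldFinite = finite-from-size setoid field-size
  open IsField isField
  open Matrices R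
  open Pfaffian R
  open Ranks R isField (finite-≟ fieldFinite)
  open IntegerSolver R
  open import Data.Nat as ℕ using (ℕ; _+_; _*_; _^_; _≤_; _<_)
  import Data.Nat.Properties as ℕ
  open import Data.Fin using (punchIn; punchOut)
  open import Data.Fin.Properties as Fin using (any?; all?; punchIn-punchOut)
  open import Data.Vec.Functional using ([]; _∷_; insertAt)
  open import Data.Vec.Functional.Properties using (insertAt-lookup; insertAt-punchIn)
  open import Data.Vec.Functional.Relation.Binary.Equality.Setoid using (≋-setoid)
  open import Data.Product.Relation.Binary.Pointwise.NonDependent using (_×ₛ_)
  open import Data.Sum.Relation.Binary.Pointwise using (_⊎ₛ_; inj₁; inj₂)
  open import Relation.Binary.Bundles using (Setoid)
  open import Relation.Nullary.Decidable using (_×-dec_; decidable-stable)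
  open import Data.Empty using (⊥)

  V : Setoid _ _
  V = record
    { Carrier = AltVertex 5
    ; _≈_ = _≈V_
    ; isEquivalence = record
      { refl = λ i j → refl ; sym = λ h i j → sym (h i j) ; trans = λ h g i j → trans (h i j) (g i j) }
    }

  -- The clique bound q⁴.

  module _ {m} (K : Fin m → AltVertex 5)
    (distinct : ∀ i j → i ≢ j → ¬ K i ≈V K j)
    (clique : ∀ i j → i ≢ j → Singular (proj₁ (K i) -M proj₁ (K j))) where

    private
      M : Fin m → Matrix 5 5
      M i = proj₁ (K i)

      -- Equal indices must be covered, since two differences compared in `polar≈0` may share a
      -- member.
      all-singular : ∀ i j → Singular (M i -M M j)
      all-singular i j with i Fin.≟ j
      ... | yes ≡.refl = ≈0-matrix-singular λ r s → -‿inverseʳ (M i r s)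
      ... | no  i≢j    = clique i j i≢j

    -- The indices are recorded beside the matrix because `polar≈0` compares the members of two
    -- differences crosswise.
    record Difference : Set (c Level.⊔ ℓ) where
      constructor difference
      field
        left right : Fin m
        left≢right : left ≢ right

      matrix : Matrix 5 5
      matrix = M left -M M right

      alternating : IsAlternating matrix
      alternating = -M-alternating (proj₂ (K left)) (proj₂ (K right))

      nonzero : ¬ (∀ i j → matrix i j ≈ 0#)
      nonzero h = distinct left right left≢right λ i j → -≈0⇒≈ (h i j)

    open Difference

    polar≈0 : ∀ X Y i j k l → polar (matrix X) (matrix Y) i j k l ≈ 0#
    polar≈0 (difference i₁ i₂ _) (difference i₃ i₄ _) = polar-differences
      (M i₁) (M i₂) (M i₃) (M i₄)
      (all-singular i₁ i₄) (all-singular i₂ i₃) (all-singular i₁ i₃) (all-singular i₂ i₄)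

    module _ (q⁴<m : q ^ 4 < m) where
      -- Pigeonhole: four entries take only q⁴ values, so two members agree in them.
      vanishing-difference : (p : Fin 4 → Fin 5 × Fin 5) →
        ∃ λ X → ∀ t → matrix X (proj₁ (p t)) (proj₂ (p t)) ≈ 0#
      vanishing-difference p
        with i , j , i≢j , eq ← finite-collision (finite-→ fieldFinite 4) q⁴<m (λ i t → M i (proj₁ (p t)) (proj₂ (p t)))
        = difference i j i≢j , λ t → ≈⇒-≈0 (eq t)

      -- A row has exactly four entries off the diagonal, and the diagonal one is zero already.
      row-vanishing-difference : ∀ a → ∃ λ X → ∀ t → matrix X a t ≈ 0#
      row-vanishing-difference a with X , h ← vanishing-difference (λ t → a , punchIn a t) = X , row
        where
        row : ∀ t → matrix X a t ≈ 0#
        row t with a Fin.≟ t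
        ... | yes ≡.refl = proj₁ (alternating X) a
        ... | no  a≢t    = ≡.subst (λ s → matrix X a s ≈ 0#) (punchIn-punchOut a≢t) (h (punchOut a≢t))

    -- If `G a k` vanished, `E` would force row `a` of `G` to vanish, and then `D` all of `G`. Hence
    -- `E` kills row `a` of `B`, `G` kills row `b` with `a` and `b` exchanged, and `D` kills the
    -- rest.
    coordinates-exhaust : ∀ D E G {a b k} → ¬ matrix D a b ≈ 0# →
      (∀ t → matrix E a t ≈ 0#) → ¬ matrix E b k ≈ 0# → (∀ t → matrix G b t ≈ 0#) →
      ∀ B → matrix B a b ≈ 0# → matrix B a k ≈ 0# → ¬ matrix B b k ≈ 0#
    coordinates-exhaust D E G {a} {b} {k} Dab≉0 Ea≈0 Ebk≉0 Gb≈0 B Bab≈0 Bak≈0 Bbk≈0 =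
      nonzero B (polar-two-rows (matrix D) (matrix B) (polar≈0 D B a b) Dab≉0 Ba≈0 Bb≈0)
      where
      Gak≉0 : ¬ matrix G a k ≈ 0#
      Gak≉0 Gak≈0 = nonzero G (polar-two-rows (matrix D) (matrix G) (polar≈0 D G a b) Dab≉0
        (polar-transfer (matrix G) (matrix E) (polar≈0 G E a b k) Ea≈0 Ebk≉0
          (alt-zero (alternating G) b a (Gb≈0 a)) Gak≈0)
        Gb≈0)
      Ba≈0 : ∀ t → matrix B a t ≈ 0#
      Ba≈0 = polar-transfer (matrix B) (matrix E) (polar≈0 B E a b k) Ea≈0 Ebk≉0 Bab≈0 Bak≈0
      Bb≈0 : ∀ t → matrix B b t ≈ 0#
      Bb≈0 = polar-transfer (matrix B) (matrix G) (polar≈0 B G b a k) Gb≈0 Gak≉0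
        (alt-zero (alternating B) a b Bab≈0) Bbk≈0

    clique-bound : m ≤ q ^ 4
    clique-bound = ℕ.≮⇒≥ λ q⁴<m →
      let
        -- Row `zero` is an arbitrary choice; what matters is that `D` has a nonzero entry.
        D , _ = row-vanishing-difference q⁴<m zero
        a , b , Dab≉0 = nonzero-entry (nonzero D)
        E , Ea≈0 = row-vanishing-difference q⁴<m a
        G , Gb≈0 = row-vanishing-difference q⁴<m b
        k , Ebk≉0 = nonzero-coordinate
          (λ Eb≈0 → nonzero E (polar-two-rows (matrix D) (matrix E) (polar≈0 D E a b) Dab≉0 Ea≈0 Eb≈0))
        -- Three positions matter; the repeated `(b , k)` fills the fourth place.
        B , h = vanishing-difference q⁴<m ((a , b) ∷ (a , k) ∷ (b , k) ∷ (b , k) ∷ [])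
      in coordinates-exhaust D E G Dab≉0 Ea≈0 Ebk≉0 Gb≈0 B (h zero) (h (suc zero)) (h (suc (suc zero)))

  2≤q : 2 ≤ q
  2≤q = finite-≤ (finite-Fin 2) fieldFinite (λ { zero → 0# ; (suc _) → 1# })
    λ { zero zero _ → ≡.refl
      ; zero (suc zero) h → contradiction (sym h) 1≉0
      ; (suc zero) zero h → contradiction h 1≉0
      ; (suc zero) (suc zero) _ → ≡.refl }

  -- Impossibility of a coclique with N ≤ α q⁴.

  module _ {α} (C : Fin α → AltVertex 5)
    (coclique : ∀ i j → i ≢ j → ¬ Singular (proj₁ (C i) -M proj₁ (C j))) where

    private
      M : Fin α → Matrix 5 5
      M i = proj₁ (C i)

    singular⇒≡ : ∀ i j → Singular (M i -M M j) → i ≡ j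
    singular⇒≡ i j sing with i Fin.≟ j
    ... | yes i≡j = i≡j
    ... | no  i≢j = contradiction sing (coclique i j i≢j)

    -- Incidence with `x` passes to `M i -M M j`, which is therefore singular. So the translates of
    -- one clique by members of the coclique are disjoint.
    meet-unique : ∀ {x A} i j → ¬ (∀ t → x t ≈ 0#) → Inc x (A -M M i) → Inc x (A -M M j) → i ≡ j
    meet-unique {x} {A} i j x≉0 inc inc′ =
      singular⇒≡ i j (Inc⇒singular x≉0 (Inc-difference {x = x} {A} {M i} {M j} inc inc′))

    shift : Fin α → (Fin 5 → Carrier) → (Fin 5 → Carrier) → AltVertex 5
    shift i x y = (λ r s → M i r s R.+ wedge x y r s) ,
      (λ r → proj₁ (proj₂ (C i)) r ⊞ proj₁ (wedge-alternating x y) r) ,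
      (λ r s → trans (+-cong (proj₂ (proj₂ (C i)) r s) (proj₂ (wedge-alternating x y) r s))
        (solve 2 (λ a b → :- a :+ :- b := :- (a :+ b)) refl _ _))

    shift-difference : ∀ {A : AltVertex 5} i x y → A ≈V shift i x y → (proj₁ A -M M i) ≈M wedge x y
    shift-difference i x y A≈ r s = trans (+-congʳ (A≈ r s))
      (solve 2 (λ a b → a :+ b :- a := b) refl (M i r s) (wedge x y r s))

    shift-Inc : ∀ {A : AltVertex 5} i x y → A ≈V shift i x y → Inc x (proj₁ A -M M i)
    shift-Inc {A} i x y A≈ =
      Inc-cong (λ _ → refl) (λ r s → sym (shift-difference {A} i x y A≈ r s)) (Inc-wedge x y)

    module _ {N} (vertices : Finite V N) (N≤ : N ≤ α * q ^ 4) where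

      -- If the disjoint translates missed `A`, then `A` and their α q⁴ members would be more than N
      -- distinct vertices.
      meet : ∀ (x : Fin 5 → Carrier) (A : AltVertex 5) → ¬ (∀ t → x t ≈ 0#) → ∃ λ i → Inc x (proj₁ A -M M i)
      meet x A x≉0 = decidable-stable (any? λ i → Inc? x (proj₁ A -M M i)) λ missed →
        ℕ.<⇒≱ (ℕ.s≤s N≤) (finite-≤ translates-finite vertices f (f-injective missed))
        where
        translates : Setoid _ _
        translates = ≡.setoid (Fin 1) ⊎ₛ (≡.setoid (Fin α) ×ₛ ≋-setoid setoid 4)

        translates-finite : Finite translates (1 + α * q ^ 4)
        translates-finite = finite-⊎ (finite-Fin 1) (finite-× (finite-Fin α) (finite-→ fieldFinite 4))

        k : Fin 5
        k = proj₁ (nonzero-coordinate x≉0)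
        xk≉0 : ¬ x k ≈ 0#
        xk≉0 = proj₂ (nonzero-coordinate x≉0)

        -- The product x ∧ y determines `y` up to multiples of `x`; as `x k` is nonzero, a zero at
        -- `k` selects one representative, leaving four free coordinates.
        y : (Fin 4 → Carrier) → Fin 5 → Carrier
        y z = insertAt z k 0#

        f : Fin 1 ⊎ (Fin α × (Fin 4 → Carrier)) → AltVertex 5
        f (inj₁ _)       = A
        f (inj₂ (i , z)) = shift i x (y z)

        wedge-injective : ∀ z z′ → wedge x (y z) ≈M wedge x (y z′) → ∀ t → z t ≈ z′ t
        wedge-injective z z′ eq t = -≈0⇒≈ (cancelˡ-≈0 xk≉0
          (trans (solve 4 (λ a b v v′ → a :* (v :- v′) := (a :* v :- b :* :0) :- (a :* v′ :- b :* :0)) refl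
              (x k) (x (punchIn k t)) (z t) (z′ t))
            (≈⇒-≈0 (≡.subst₂ _≈_ (entry z) (entry z′) (eq k (punchIn k t))))))
          where
          entry : ∀ z → wedge x (y z) k (punchIn k t) ≡ x k R.* z t - x (punchIn k t) R.* 0#
          entry z = ≡.cong₂ (λ v w → x k R.* v - x (punchIn k t) R.* w) (insertAt-punchIn z k 0# t) (insertAt-lookup z k 0#)

        shifts-injective : ∀ i j → i ≡ j → ∀ z z′ → shift i x (y z) ≈V shift j x (y z′) → ∀ t → z t ≈ z′ t
        shifts-injective i j ≡.refl z z′ eq = wedge-injective z z′ λ r s →
          trans (sym (shift-difference {shift i x (y z)} i x (y z) (λ _ _ → refl) r s))
            (shift-difference {shift i x (y z)} i x (y z′) eq r s)

        f-injective : ¬ (∃ λ i → Inc x (proj₁ A -M M i)) → ∀ u v → f u ≈V f v → Setoid._≈_ translates u v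
        f-injective missed (inj₁ zero) (inj₁ zero) _ = inj₁ ≡.refl
        f-injective missed (inj₁ _) (inj₂ (i , z)) eq = contradiction (i , shift-Inc {A} i x (y z) eq) missed
        f-injective missed (inj₂ (i , z)) (inj₁ _) eq =
          contradiction (i , shift-Inc {A} i x (y z) (λ r s → sym (eq r s))) missed
        f-injective missed (inj₂ (i , z)) (inj₂ (j , z′)) eq = inj₂ (i≡j , shifts-injective i j i≡j z z′ eq)
          where
          i≡j : i ≡ j
          i≡j = meet-unique {x} {proj₁ (shift i x (y z))} i j x≉0
            (shift-Inc {shift i x (y z)} i x (y z) (λ _ _ → refl))
            (shift-Inc {shift i x (y z)} j x (y z′) eq)

      e₀ e₁ : Fin 5 → Carrier
      e₀ = 1# ∷ λ _ → 0#
      e₁ = 0# ∷ 1# ∷ λ _ → 0#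

      wedge-e₀e₁≉0 : ¬ (∀ r s → wedge e₀ e₁ r s ≈ 0#)
      wedge-e₀e₁≉0 h = 1≉0 (trans (solve 1 (λ a → a := a :* a :- :0 :* :0 :+ (a :- a :* a)) refl 1#)
        (h zero (suc zero) ⊞ ≈⇒-≈0 (sym (*-identityʳ 1#))))

      -- The vertex `C i₀` plus e₀ ∧ e₁ differs from `C i₀` by a nonzero singular matrix, so the
      -- coclique cannot contain it.
      outside : ∃ λ (A : AltVertex 5) → ∀ i → ¬ A ≈V C i
      outside = A , λ i A≈Ci → A∉C i A≈Ci (singular⇒≡ i i₀ (singular-cong
          (λ r s → trans (sym (shift-difference {A} i₀ e₀ e₁ (λ _ _ → refl) r s)) (+-congʳ (A≈Ci r s)))
          (wedge-singular e₀ e₁)))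
        where
        i₀ : Fin α
        -- Covering the zero matrix shows that the coclique is nonempty.
        i₀ = proj₁ (meet e₀ ((λ _ _ → 0#) , (λ _ → refl) , (λ _ _ → sym (≈0-neg refl))) (λ h → 1≉0 (h zero)))
        A : AltVertex 5
        A = shift i₀ e₀ e₁
        A∉C : ∀ i → A ≈V C i → i ≢ i₀
        A∉C i A≈Ci ≡.refl = wedge-e₀e₁≉0 λ r s →
          trans (sym (shift-difference {A} i₀ e₀ e₁ (λ _ _ → refl) r s)) (≈⇒-≈0 (A≈Ci r s))

      -- To count nonzero vectors without subtraction, the neighbours of A are added to the
      -- q ^ 5 vectors, standing for the zero vectors of the planes they span.
      module Planes (A : AltVertex 5) (A∉C : ∀ i → ¬ A ≈V C i) where
        D : Fin α → Matrix 5 5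
        D i = proj₁ A -M M i

        D-alternating : ∀ i → IsAlternating (D i)
        D-alternating i = -M-alternating (proj₂ A) (proj₂ (C i))

        -- The indices of a nonzero entry serve as coordinates on the row space when `D i` is
        -- singular.
        pivot : ∀ i → ∃ λ r → ∃ λ s → ¬ D i r s ≈ 0#
        pivot i = nonzero-entry λ h → A∉C i λ r s → -≈0⇒≈ (h r s)

        row column : Fin α → Fin 5
        row i    = proj₁ (pivot i)
        column i = proj₁ (proj₂ (pivot i))

        D-pivot≉0 : ∀ i → ¬ D i (row i) (column i) ≈ 0#
        D-pivot≉0 i = proj₂ (proj₂ (pivot i))

        pivot⁻¹ : Fin α → Carrier
        pivot⁻¹ i = proj₁ (inverse _ (D-pivot≉0 i))

        -- Each `D i` is nonzero because `A` is outside the coclique, so singular means rank 2 here.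
        neighbours : Setoid _ _
        neighbours = subset-setoid (λ i → Singular (D i))

        degree : ℕ
        degree = proj₁ (finite-subset (λ i → singular? (D i)))

        neighbours-finite : Finite neighbours degree
        neighbours-finite = proj₂ (finite-subset (λ i → singular? (D i)))

        vectors pairs-and-zero : Setoid _ _
        vectors = ≋-setoid setoid 5 ⊎ₛ neighbours
        pairs-and-zero = ≡.setoid (Fin 1) ⊎ₛ (neighbours ×ₛ (setoid ×ₛ setoid))

        vectors-finite : Finite vectors (q ^ 5 + degree)
        vectors-finite = finite-⊎ (finite-→ fieldFinite 5) neighbours-finite

        pairs-and-zero-finite : Finite pairs-and-zero (1 + degree * (q * q))
        pairs-and-zero-finite =
          finite-⊎ (finite-Fin 1) (finite-× neighbours-finite (finite-× fieldFinite fieldFinite))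

        zero? : (x : Fin 5 → Carrier) → Dec (∀ t → x t ≈ 0#)
        zero? x = all? λ t → finite-≟ fieldFinite (x t) 0#

        coordinates-determine : ∀ {i j x y} → i ≡ j → Inc x (D i) → Inc y (D j) →
          x (row i) ≈ y (row j) → x (column i) ≈ y (column j) → ∀ t → x t ≈ y t
        coordinates-determine {i} {_} {x} {y} ≡.refl incx incy hr hc t =
          -≈0⇒≈ (cancelˡ-≈0 (D-pivot≉0 i) (Inc-determined {x = x} {y} {D i} (row i) (column i) incx incy hr hc t))

        Inc-zero : ∀ i → Inc (λ _ → 0#) (D i)
        Inc-zero i r s t = solve 3 (λ a b d → :0 :* a :- :0 :* b :+ :0 :* d := :0) refl _ _ _

        -- A nonzero vector goes to the neighbour whose plane contains it, with its pivot
        -- coordinates. The decision is an argument so that injectivity can be proved by cases.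
        φ′ : ∀ x → Dec (∀ t → x t ≈ 0#) → Setoid.Carrier pairs-and-zero
        φ′ x (yes _)  = inj₁ zero
        φ′ x (no x≉0) = inj₂ ((i , Inc⇒singular x≉0 inc) , x (row i) , x (column i))
          where
          i   = proj₁ (meet x A x≉0)
          inc = proj₂ (meet x A x≉0)

        φ : Setoid.Carrier vectors → Setoid.Carrier pairs-and-zero
        φ (inj₁ x) = φ′ x (zero? x)
        φ (inj₂ i) = inj₂ (i , 0# , 0#)

        φ′-injective : ∀ x y dx dy → Setoid._≈_ pairs-and-zero (φ′ x dx) (φ′ y dy) → ∀ t → x t ≈ y t
        φ′-injective x y (yes x≈0) (yes y≈0) _ t = trans (x≈0 t) (sym (y≈0 t))
        φ′-injective x y (no x≉0) (no y≉0) (inj₂ (i≡j , hr , hc)) =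
          coordinates-determine i≡j (proj₂ (meet x A x≉0)) (proj₂ (meet y A y≉0)) hr hc

        -- Zero pivot coordinates would make `x` agree with the zero vector, which lies in every
        -- plane.
        φ′-nonzero : ∀ x i dx → ¬ Setoid._≈_ pairs-and-zero (φ′ x dx) (φ (inj₂ i))
        φ′-nonzero x i (no x≉0) (inj₂ (i≡j , hr , hc)) =
          x≉0 (coordinates-determine ≡.refl (proj₂ (meet x A x≉0)) (Inc-zero _) hr hc)

        φ-injective : ∀ u v → Setoid._≈_ pairs-and-zero (φ u) (φ v) → Setoid._≈_ vectors u v
        φ-injective (inj₁ x) (inj₁ y) eq = inj₁ (φ′-injective x y (zero? x) (zero? y) eq)
        φ-injective (inj₁ x) (inj₂ i) eq = contradiction eq (φ′-nonzero x i (zero? x))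
        φ-injective (inj₂ i) (inj₁ x) eq =
          contradiction (Setoid.sym pairs-and-zero {φ (inj₂ i)} {φ (inj₁ x)} eq) (φ′-nonzero x i (zero? x))
        φ-injective (inj₂ i) (inj₂ j) (inj₂ (i≡j , _)) = inj₂ i≡j

        both-zero? : ∀ u v → Dec (u ≈ 0# × v ≈ 0#)
        both-zero? u v = finite-≟ fieldFinite u 0# ×-dec finite-≟ fieldFinite v 0#

        plane : Fin α → Carrier → Carrier → Fin 5 → Carrier
        plane i u v = span (D i) (row i) (column i) (pivot⁻¹ i) u v

        plane-row : ∀ i u v → plane i u v (row i) ≈ u
        plane-row i u v = span-left (D-alternating i) (row i) (column i) u v (proj₂ (inverse _ (D-pivot≉0 i)))

        plane-column : ∀ i u v → plane i u v (column i) ≈ v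
        plane-column i u v = span-right (D-alternating i) (row i) (column i) u v (proj₂ (inverse _ (D-pivot≉0 i)))

        plane-Inc : ∀ i u v → Singular (D i) → Inc (plane i u v) (D i)
        plane-Inc i u v sing = span-Inc sing (row i) (column i) (pivot⁻¹ i) u v

        plane≉0 : ∀ i u v → ¬ (u ≈ 0# × v ≈ 0#) → ¬ (∀ t → plane i u v t ≈ 0#)
        plane≉0 i u v uv≉0 h =
          uv≉0 (trans (sym (plane-row i u v)) (h (row i)) , trans (sym (plane-column i u v)) (h (column i)))

        -- The origin of each plane goes to the extra copy of its neighbour, as the zero vector is
        -- already the image of the `Fin 1` summand.
        ψ′ : (i : ∃ λ i → Singular (D i)) → ∀ u v → Dec (u ≈ 0# × v ≈ 0#) → Setoid.Carrier vectors
        ψ′ i u v (yes _) = inj₂ i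
        ψ′ i u v (no _)  = inj₁ (plane (proj₁ i) u v)

        ψ : Setoid.Carrier pairs-and-zero → Setoid.Carrier vectors
        ψ (inj₁ _)           = inj₁ λ _ → 0#
        ψ (inj₂ (i , u , v)) = ψ′ i u v (both-zero? u v)

        ψ′-nonzero : ∀ i u v d → ¬ Setoid._≈_ vectors (inj₁ λ _ → 0#) (ψ′ i u v d)
        ψ′-nonzero i u v (no uv≉0) (inj₁ eq) = plane≉0 (proj₁ i) u v uv≉0 λ t → sym (eq t)

        plane-injective : ∀ {i j} → i ≡ j → ∀ u v u′ v′ → (∀ t → plane i u v t ≈ plane j u′ v′ t) → u ≈ u′ × v ≈ v′
        plane-injective {i} ≡.refl u v u′ v′ eq =
          trans (sym (plane-row i u v)) (trans (eq (row i)) (plane-row i u′ v′)) ,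
          trans (sym (plane-column i u v)) (trans (eq (column i)) (plane-column i u′ v′))

        -- Two planes share only the origin: by `meet-unique` a nonzero common vector identifies
        -- their neighbours, and the pivot coordinates then recover the pair.
        ψ′-injective : ∀ i j u v u′ v′ d d′ → Setoid._≈_ vectors (ψ′ i u v d) (ψ′ j u′ v′ d′) →
          proj₁ i ≡ proj₁ j × u ≈ u′ × v ≈ v′
        ψ′-injective i j u v u′ v′ (yes (u≈0 , v≈0)) (yes (u′≈0 , v′≈0)) (inj₂ i≡j) =
          i≡j , trans u≈0 (sym u′≈0) , trans v≈0 (sym v′≈0)
        ψ′-injective (i , sing) (j , sing′) u v u′ v′ (no uv≉0) (no _) (inj₁ eq) =
          i≡j , plane-injective i≡j u v u′ v′ eq
          where
          i≡j : i ≡ j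
          i≡j = meet-unique {plane j u′ v′} {proj₁ A} i j
            (λ h → plane≉0 i u v uv≉0 λ t → trans (eq t) (h t))
            (Inc-cong eq (λ _ _ → refl) (plane-Inc i u v sing))
            (plane-Inc j u′ v′ sing′)

        ψ-injective : ∀ p p′ → Setoid._≈_ vectors (ψ p) (ψ p′) → Setoid._≈_ pairs-and-zero p p′
        ψ-injective (inj₁ zero) (inj₁ zero) _ = inj₁ ≡.refl
        ψ-injective (inj₁ _) (inj₂ (i , u , v)) eq = contradiction eq (ψ′-nonzero i u v (both-zero? u v))
        ψ-injective (inj₂ (i , u , v)) (inj₁ z) eq =
          contradiction (Setoid.sym vectors {ψ (inj₂ (i , u , v))} {ψ (inj₁ z)} eq) (ψ′-nonzero i u v (both-zero? u v))
        ψ-injective (inj₂ (i , u , v)) (inj₂ (j , u′ , v′)) eq =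
          inj₂ (ψ′-injective i j u v u′ v′ (both-zero? u v) (both-zero? u′ v′) eq)

        -- The nonzero vectors are partitioned by the planes, q² - 1 in each; injections both ways
        -- give the equality.
        partition-count : q ^ 5 + degree ≡ 1 + degree * (q * q)
        partition-count = ℕ.≤-antisym
          (finite-≤ vectors-finite pairs-and-zero-finite φ φ-injective)
          (finite-≤ pairs-and-zero-finite vectors-finite ψ ψ-injective)

      tight-coclique-impossible : ⊥
      tight-coclique-impossible = counts-incompatible degree 2≤q partition-count
        where open Planes (proj₁ outside) (proj₂ outside)

-- From clique and coclique lists to the strict inequality.

open import Data.Nat using (ℕ; _*_; _^_; _≤_; _<_; _≥_)
open import Data.Nat.Primality using (Prime)

theorem3p13 : ∀ {c ℓ} (p m : ℕ) → Prime p → m ≥ 1 →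
    (F : CommutativeRing c ℓ) → IsField F →
    HasSize (CommutativeRing.Carrier F) (CommutativeRing._≈_ F) (p ^ m) →
    ∀ (N ω α : ℕ) →
    HasSize (Matrices.AltVertex F 5) (Matrices._≈V_ F) N →
    Graph.IsCliqueNumber (Matrices.AltVertex F 5) (Matrices._≈V_ F) (Matrices.AltAdj F) ω →
    Graph.IsCocliqueNumber (Matrices.AltVertex F 5) (Matrices._≈V_ F) (Matrices.AltAdj F) α →
    ω * α < N
theorem3p13 p m _ _ F isField field-size N ω α vertices ((K , clique , ≡.refl) , _) ((C , coclique , ≡.refl) , _) =
  -- Combining N ≤ ω α with ω ≤ q⁴ gives N ≤ α q⁴, where q is `p ^ m`.
  ℕ.≰⇒> λ N≤ωα → tight-coclique-impossible (lookup C) C-independent (finite-from-size V vertices)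
    (ℕ.≤-trans N≤ωα (ℕ.≤-trans (ℕ.*-monoˡ-≤ (length C) ω≤q⁴) (ℕ.≤-reflexive (ℕ.*-comm ((p ^ m) ^ 4) (length C)))))
  where
  open import Data.List using (length; lookup)
  open import Data.List.Relation.Unary.AllPairs as AllPairs using ()
  import Data.Nat.Properties as ℕ
  open CommutativeRing F using (sym)
  open Enumeration using (AllPairs-lookup; finite-from-size; finite-≟)
  open Matrices F
  open Pfaffian F using (Singular; -M-alternating; -≈0⇒≈; singular-difference-sym)
  open Separation F isField field-size
  open Ranks F isField (finite-≟ fieldFinite) using (rank2⇒singular; singular⇒rank2)

  K-pairs : ∀ i j → i ≢ j →
    ¬ lookup K i ≈V lookup K j × Singular (proj₁ (lookup K i) -M proj₁ (lookup K j))
  K-pairs = AllPairs-lookup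
    (λ {A} {B} (A≉B , sing) → (λ B≈A → A≉B λ i j → sym (B≈A i j)) , singular-difference-sym {A = proj₁ A} {proj₁ B} sing)
    (AllPairs.map (λ {A} {B} (A≉B , adj) → A≉B , rank2⇒singular (-M-alternating (proj₂ A) (proj₂ B)) adj) clique)

  ω≤q⁴ : length K ≤ (p ^ m) ^ 4
  ω≤q⁴ = clique-bound (lookup K) (λ i j i≢j → proj₁ (K-pairs i j i≢j)) (λ i j i≢j → proj₂ (K-pairs i j i≢j))

  -- Distinctness excludes the zero difference, which is singular without having rank 2; any other
  -- singular difference would be an adjacency.
  C-independent : ∀ i j → i ≢ j → ¬ Singular (proj₁ (lookup C i) -M proj₁ (lookup C j))
  C-independent = AllPairs-lookup
    (λ {A} {B} h sing → h (singular-difference-sym {A = proj₁ B} {proj₁ A} sing))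
    (AllPairs.map (λ {A} {B} (A≉B , ¬adj) sing → ¬adj
      (singular⇒rank2 (-M-alternating (proj₂ A) (proj₂ B)) sing λ h → A≉B λ i j → -≈0⇒≈ (h i j))) coclique)
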